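{- Let $n,p,k$ be positive integers. The positive number $\binom{n}{p}_k$ is an integer.
   Context: For an indeterminate $a$ and an integer $r\ge 0$, $(a)_r=a(a+1)\cdots(a+r-1)$ denotes the raising factorial, with $(a)_0=1$. For any positive integers $n,p,k$, define $$\binom{n}{p}_k=\binom{n}{k}\;{}_3F_2\!\left[\begin{matrix}1-k,\,-p,\,p-n\\ 1-n,\,1\end{matrix};1\right]=\binom{n}{k}\sum_{r\ge 0}\frac{(1-k)_r\,(-p)_r\,(p-n)_r}{(1-n)_r\,(1)_r\,r!},$$ where $\binom{n}{k}$ is the usual binomial coefficient, equal to $0$ for $k>n$. For $k\le n$ the sum terminates, since $(1-k)_r=0$ for $r\ge k$; for $k>n$ one has $\binom{n}{p}_k=0$ because of the factor $\binom{n}{k}$. The definition can be rewritten as $$\binom{n}{p}_k=\frac{n}{k}\sum_{r\ge 0}\binom{p}{r}\binom{n-p}{r}\binom{n-r-1}{k-r-1}.$$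
   Formalization: Integrality is proved for all positive n, p, k; positivity is asserted only for p ≤ n and k ≤ n, since it fails in general: the number is 0 for k > n, and equals −2 for n = k = 2, p = 3. -}

module Defs where

open import Data.Nat as ℕ using (ℕ; zero; suc; _!)
import Data.Nat.Properties as ℕ
open import Data.Nat.Combinatorics using (_C_)
open import Data.Integer as ℤ using (ℤ; +_)
import Data.Integer.Properties as ℤ
open import Data.Integer.Tactic.RingSolver using (solve-∀)
open import Data.Rational using (ℚ; 0ℚ; _/_; _÷_; _+_; _*_; _≟_; ≢-nonZero)
open import Data.Product using (∃-syntax)
open import Data.Sum using ([_,_]′)
open import Function using (_∘_)
open import Relation.Nullary using (yes; no)
open import Relation.Binary.PropositionalEquality
  using (_≡_; _≢_; refl; sym; trans; cong)

IsInteger : ℚ → Set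
IsInteger q = ∃[ z ] q ≡ z / 1

rising : ℤ → ℕ → ℤ
rising a zero    = + 1
rising a (suc r) = rising a r ℤ.* (a ℤ.+ + r)

-- Division extended by x ÷₀ 0 = 0.  Wherever it matters in ⟨_,_⟩_ below,
-- the divisor is nonzero: see rising-nonzero.
_÷₀_ : ℚ → ℚ → ℚ
x ÷₀ y with y ≟ 0ℚ
... | yes _   = 0ℚ
... | no  y≢0 = _÷_ x y {{≢-nonZero y≢0}}

sum< : ℕ → (ℕ → ℚ) → ℚ
sum< zero    f = 0ℚ
sum< (suc m) f = sum< m f + f m

₃F₂-term : (a₁ a₂ a₃ b₁ b₂ : ℤ) → ℕ → ℚ
₃F₂-term a₁ a₂ a₃ b₁ b₂ r =
  ((rising a₁ r ℤ.* rising a₂ r ℤ.* rising a₃ r) / 1)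
    ÷₀ ((rising b₁ r ℤ.* rising b₂ r ℤ.* + (r !)) / 1)

-- ⟨ n , p ⟩ k is the number written as the binomial symbol (n over p) with
-- subscript k.  The series is cut at r < k because its terms contain (1-k)_r,
-- which is zero for r ≥ k: see rising-vanishes.
⟨_,_⟩_ : ℕ → ℕ → ℕ → ℚ
⟨ n , p ⟩ k =
  (+ (n C k) / 1) *
    sum< k (₃F₂-term (+ 1 ℤ.- + k) (ℤ.- + p) (+ p ℤ.- + n) (+ 1 ℤ.- + n) (+ 1))

private
  shift : ∀ k r → (+ 1 ℤ.- k) ℤ.+ r ≡ (+ 1 ℤ.+ r) ℤ.- k
  shift = solve-∀

rising-vanishes : ∀ {k r} → 1 ℕ.≤ k → k ℕ.≤ r → rising (+ 1 ℤ.- + k) r ≡ + 0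
rising-vanishes {suc k} {suc r} 1≤k k≤r with suc k ℕ.≟ suc r
... | yes refl = trans
  (cong (rising (+ 1 ℤ.- + suc k) r ℤ.*_)
    (trans (shift (+ suc k) (+ r)) (ℤ.+-inverseʳ (+ suc k))))
  (ℤ.*-zeroʳ (rising (+ 1 ℤ.- + suc k) r))
... | no k≢r = cong (ℤ._* ((+ 1 ℤ.- + suc k) ℤ.+ + r))
  (rising-vanishes 1≤k (ℕ.s≤s⁻¹ (ℕ.≤∧≢⇒< k≤r k≢r)))

rising-nonzero : ∀ {n} r → r ℕ.< n → rising (+ 1 ℤ.- + n) r ≢ + 0
rising-nonzero     zero    _   ()
rising-nonzero {n} (suc r) r<n eq =
  [ rising-nonzero r (ℕ.<-trans (ℕ.n<1+n r) r<n)
  , (λ e → ℕ.<⇒≢ r<n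
      (ℤ.+-injective (ℤ.i-j≡0⇒i≡j (+ suc r) (+ n)
        (trans (sym (shift (+ n) (+ r))) e))))
  ]′ (ℤ.i*j≡0⇒i≡0∨j≡0 (rising (+ 1 ℤ.- + n) r) eq)

{-# OPTIONS --safe #-}
module Submission where

open import Defs
open import Data.Nat using (ℕ; NonZero; _≤_)
open import Data.Product using (_×_)
open import Data.Rational using (Positive)

open import Data.Nat as ℕ using (zero; suc; _<_; _∸_; _!; s≤s; z≤n)
import Data.Nat.Properties as ℕ
open import Data.Nat.Combinatorics
  using (_C_; k>n⇒nCk≡0; nCk+nC[k+1]≡[n+1]C[k+1]; nC1≡n)
import Data.Nat.Tactic.RingSolver as ℕ-Ring
open import Data.Integer as ℤ using (ℤ; +_; -[1+_]; 0ℤ; 1ℤ)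
import Data.Integer.Properties as ℤ
open import Data.Integer.Divisibility.Signed using (_∣_; divides; ∣m∣n⇒∣m+n; ∣m+n∣n⇒∣m)
open import Data.Integer.Tactic.RingSolver using (solve-∀)
open import Data.Rational as ℚ using (ℚ; 0ℚ; _/_; ≢-nonZero)
import Data.Rational.Properties as ℚ
open import Data.Rational.Unnormalised as ℚᵘ using (mkℚᵘ; *≡*)
import Data.Rational.Unnormalised.Properties as ℚᵘ
open import Data.Product using (_,_; ∃-syntax; map₂; proj₁; proj₂)
open import Data.Sum using (inj₁; inj₂)
open import Function using (_∘_)
open import Relation.Nullary using (yes; no; contradiction)
open import Relation.Binary.PropositionalEquality
open ≡-Reasoning

-- Write n = p + q (q may be negative) and ₍a₎ᵣ = (a)ᵣ / r!, an integer
-- (multichoose a r below), so that with α = - p, β = - q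
-- the r-th term of k ⟨ n , p ⟩ k is  n Uᵣ C(n-r-1, k-r-1),  Uᵣ = ₍α₎ᵣ ₍β₎ᵣ.
-- Modulo k this is the telescoping difference Gᵣ₊₁ - Gᵣ, where
-- Gᵣ = r (Uᵣ - Wᵣ) C(n-r-1, k-r) and Wᵣ = ₍α+1₎ᵣ ₍β+1₎ᵣ, because
-- r (Uᵣ - Wᵣ) = (n - r) Wᵣ₋₁.  As G₀ = 0 and k ∣ Gₖ, the sum is divisible by k.

-- Absorption identities and positivity for binomial coefficients.

absorption : ∀ n k → suc k ℕ.* (suc n C suc k) ≡ suc n ℕ.* (n C k)
absorption zero    zero    = refl
absorption zero    (suc k) = begin
  suc (suc k) ℕ.* (1 C suc (suc k)) ≡⟨ cong (suc (suc k) ℕ.*_) (k>n⇒nCk≡0 {1} {suc (suc k)} (s≤s (s≤s z≤n))) ⟩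
  suc (suc k) ℕ.* 0                 ≡⟨ ℕ.*-zeroʳ (suc (suc k)) ⟩
  0                                 ≡⟨ cong (1 ℕ.*_) (k>n⇒nCk≡0 {0} {suc k} (s≤s z≤n)) ⟨
  1 ℕ.* (0 C suc k)                 ∎
absorption (suc n) zero    =
  trans (cong (1 ℕ.*_) (nC1≡n (suc (suc n)))) (ℕ.*-comm 1 (suc (suc n)))
absorption (suc n) (suc k) = begin
  suc (suc k) ℕ.* (suc (suc n) C suc (suc k))
    ≡⟨ cong (suc (suc k) ℕ.*_) (nCk+nC[k+1]≡[n+1]C[k+1] (suc n) (suc k)) ⟨
  suc (suc k) ℕ.* (x ℕ.+ y)
    ≡⟨ expand k x y ⟩
  suc k ℕ.* x ℕ.+ suc (suc k) ℕ.* y ℕ.+ x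
    ≡⟨ cong₂ (λ u v → u ℕ.+ v ℕ.+ x) (absorption n k) (absorption n (suc k)) ⟩
  suc n ℕ.* (n C k) ℕ.+ suc n ℕ.* (n C suc k) ℕ.+ x
    ≡⟨ cong (ℕ._+ x) (ℕ.*-distribˡ-+ (suc n) (n C k) (n C suc k)) ⟨
  suc n ℕ.* (n C k ℕ.+ n C suc k) ℕ.+ x
    ≡⟨ cong (λ z → suc n ℕ.* z ℕ.+ x) (nCk+nC[k+1]≡[n+1]C[k+1] n k) ⟩
  suc n ℕ.* x ℕ.+ x
    ≡⟨ ℕ.+-comm (suc n ℕ.* x) x ⟩
  suc (suc n) ℕ.* x ∎
  where
  x = suc n C suc k
  y = suc n C suc (suc k)
  expand : ∀ k x y → suc (suc k) ℕ.* (x ℕ.+ y) ≡ suc k ℕ.* x ℕ.+ suc (suc k) ℕ.* y ℕ.+ x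
  expand = ℕ-Ring.solve-∀

-- Truncated subtraction admits `n = 0`, where both sides vanish. The telescoping reaches this case
-- when `n = suc m`.
absorption-∸ : ∀ n k → suc k ℕ.* (n C suc k) ≡ n ℕ.* ((n ∸ 1) C k)
absorption-∸ zero    k = trans
  (cong (suc k ℕ.*_) (k>n⇒nCk≡0 {0} {suc k} (s≤s z≤n))) (ℕ.*-zeroʳ (suc k))
absorption-∸ (suc n) k = absorption n k

0<nCk : ∀ {n k} → k ≤ n → 0 < n C k
0<nCk {n}     {zero}  _         = ℕ.s≤s z≤n
0<nCk {suc n} {suc k} (s≤s k≤n) = subst (0 <_) (nCk+nC[k+1]≡[n+1]C[k+1] n k)
  (ℕ.<-≤-trans (0<nCk k≤n) (ℕ.m≤m+n (n C k) (n C suc k)))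

absorptionℤ : ∀ n k → + suc k ℤ.* + (n C suc k) ≡ + n ℤ.* + ((n ∸ 1) C k)
absorptionℤ n k = begin
  + suc k ℤ.* + (n C suc k)  ≡⟨ ℤ.pos-* (suc k) (n C suc k) ⟨
  + (suc k ℕ.* (n C suc k))  ≡⟨ cong +_ (absorption-∸ n k) ⟩
  + (n ℕ.* ((n ∸ 1) C k))    ≡⟨ ℤ.pos-* n ((n ∸ 1) C k) ⟩
  + n ℤ.* + ((n ∸ 1) C k)    ∎

-- Absorption for `suc n C suc k`, with that coefficient expanded by Pascal's rule.
pascal-absorptionℤ : ∀ n k →
  + suc n ℤ.* + (n C k) ≡ + suc k ℤ.* (+ (n C k) ℤ.+ + (n C suc k))
pascal-absorptionℤ n k = begin
  + suc n ℤ.* + (n C k)                         ≡⟨ absorptionℤ (suc n) k ⟨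
  + suc k ℤ.* + (suc n C suc k)                 ≡⟨ cong (λ z → + suc k ℤ.* + z) (nCk+nC[k+1]≡[n+1]C[k+1] n k) ⟨
  + suc k ℤ.* (+ (n C k) ℤ.+ + (n C suc k))     ∎

-- Rising factorials and their divisibility by `r !`.

rising-sucˡ : ∀ a r → rising a (suc r) ≡ a ℤ.* rising (1ℤ ℤ.+ a) r
rising-sucˡ a zero    = base a
  where
  base : ∀ a → 1ℤ ℤ.* (a ℤ.+ 0ℤ) ≡ a ℤ.* 1ℤ
  base = solve-∀
rising-sucˡ a (suc r) = trans
  (cong (ℤ._* (a ℤ.+ + suc r)) (rising-sucˡ a r))
  (step a (+ r) (rising (1ℤ ℤ.+ a) r))
  where
  step : ∀ a r x → a ℤ.* x ℤ.* (a ℤ.+ (1ℤ ℤ.+ r)) ≡ a ℤ.* (x ℤ.* ((1ℤ ℤ.+ a) ℤ.+ r))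
  step = solve-∀

!-suc : ∀ r → + (suc r !) ≡ + suc r ℤ.* + (r !)
!-suc r = ℤ.pos-* (suc r) (r !)

-- Both rising factorials contain (1+a)ᵣ; the remaining factors are `1 + a + r` and `a`, which
-- differ by `suc r`.
rising-difference : ∀ a r → rising (1ℤ ℤ.+ a) (suc r) ≡
  rising a (suc r) ℤ.+ + suc r ℤ.* rising (1ℤ ℤ.+ a) r
rising-difference a r = trans
  (expand a (+ r) (rising (1ℤ ℤ.+ a) r))
  (cong (ℤ._+ + suc r ℤ.* rising (1ℤ ℤ.+ a) r) (sym (rising-sucˡ a r)))
  where
  expand : ∀ a r x → x ℤ.* ((1ℤ ℤ.+ a) ℤ.+ r) ≡ a ℤ.* x ℤ.+ (1ℤ ℤ.+ r) ℤ.* x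
  expand = solve-∀

-- Induction on `r`, and for `suc r` induction on `a` in both directions from `a = 0`, where the
-- product is zero. Neighbouring values differ by `suc r` times a rising factorial of length `r`,
-- which `suc r !` divides by the induction hypothesis.
!∣rising : ∀ r a → + (r !) ∣ rising a r
!∣rising zero    a = divides 1ℤ refl
!∣rising (suc r) = go
  where
  summand : ∀ a → + (suc r !) ∣ + suc r ℤ.* rising (1ℤ ℤ.+ a) r
  summand a with divides q eq ← !∣rising r (1ℤ ℤ.+ a) = divides q (begin
    + suc r ℤ.* rising (1ℤ ℤ.+ a) r    ≡⟨ cong (+ suc r ℤ.*_) eq ⟩
    + suc r ℤ.* (q ℤ.* + (r !))        ≡⟨ swap (+ suc r) q (+ (r !)) ⟩
    q ℤ.* (+ suc r ℤ.* + (r !))        ≡⟨ cong (q ℤ.*_) (!-suc r) ⟨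
    q ℤ.* + (suc r !)                  ∎)
    where
    swap : ∀ x y z → x ℤ.* (y ℤ.* z) ≡ y ℤ.* (x ℤ.* z)
    swap = solve-∀

  up : ∀ a → + (suc r !) ∣ rising a (suc r) → + (suc r !) ∣ rising (1ℤ ℤ.+ a) (suc r)
  up a d = subst (+ (suc r !) ∣_) (sym (rising-difference a r))
    (∣m∣n⇒∣m+n d (summand a))

  down : ∀ a → + (suc r !) ∣ rising (1ℤ ℤ.+ a) (suc r) → + (suc r !) ∣ rising a (suc r)
  down a d = ∣m+n∣n⇒∣m (subst (+ (suc r !) ∣_) (rising-difference a r) d) (summand a)

  go : ∀ a → + (suc r !) ∣ rising a (suc r)
  go (+ zero)      = divides 0ℤ (rising-sucˡ 0ℤ r)
  go (+ suc n)     = up (+ n) (go (+ n))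
  go -[1+ zero ]   = down -[1+ zero ] (go (+ zero))
  go -[1+ suc n ]  = down -[1+ suc n ] (go -[1+ n ])

-- Multichoose coefficients and the identity for the product of two of them.

multichoose : ℤ → ℕ → ℤ
multichoose a r = _∣_.quotient (!∣rising r a)

rising-multichoose : ∀ a r → rising a r ≡ multichoose a r ℤ.* + (r !)
rising-multichoose a r = _∣_.equality (!∣rising r a)

!≢0ℤ : ∀ r → + (r !) ≢ 0ℤ
!≢0ℤ r = ℕ.≢-nonZero⁻¹ (r !) {{r ℕ.!≢0}} ∘ ℤ.+-injective

-- Source of the two recurrences that follow: `rising a (suc r)` is split at its last or first
-- factor, and `r !` is cancelled.
multichoose-suc-scaled : ∀ a r →
  (+ suc r ℤ.* multichoose a (suc r)) ℤ.* + (r !) ≡ rising a (suc r)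
multichoose-suc-scaled a r = begin
  (+ suc r ℤ.* multichoose a (suc r)) ℤ.* + (r !) ≡⟨ swap (+ suc r) (multichoose a (suc r)) (+ (r !)) ⟩
  multichoose a (suc r) ℤ.* (+ suc r ℤ.* + (r !)) ≡⟨ cong (multichoose a (suc r) ℤ.*_) (!-suc r) ⟨
  multichoose a (suc r) ℤ.* + (suc r !)           ≡⟨ rising-multichoose a (suc r) ⟨
  rising a (suc r)                                ∎
  where
  swap : ∀ x y z → (x ℤ.* y) ℤ.* z ≡ y ℤ.* (x ℤ.* z)
  swap = solve-∀

multichoose-sucʳ : ∀ a r →
  + suc r ℤ.* multichoose a (suc r) ≡ (a ℤ.+ + r) ℤ.* multichoose a r
multichoose-sucʳ a r = ℤ.*-cancelʳ-≡ _ _ (+ (r !)) {{ℤ.≢-nonZero (!≢0ℤ r)}} (begin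
  (+ suc r ℤ.* multichoose a (suc r)) ℤ.* + (r !)   ≡⟨ multichoose-suc-scaled a r ⟩
  rising a r ℤ.* (a ℤ.+ + r)                        ≡⟨ cong (ℤ._* (a ℤ.+ + r)) (rising-multichoose a r) ⟩
  multichoose a r ℤ.* + (r !) ℤ.* (a ℤ.+ + r)       ≡⟨ swap (multichoose a r) (+ (r !)) (a ℤ.+ + r) ⟩
  (a ℤ.+ + r) ℤ.* multichoose a r ℤ.* + (r !)       ∎)
  where
  swap : ∀ x y z → x ℤ.* y ℤ.* z ≡ z ℤ.* x ℤ.* y
  swap = solve-∀

multichoose-sucˡ : ∀ a r →
  + suc r ℤ.* multichoose a (suc r) ≡ a ℤ.* multichoose (1ℤ ℤ.+ a) r
multichoose-sucˡ a r = ℤ.*-cancelʳ-≡ _ _ (+ (r !)) {{ℤ.≢-nonZero (!≢0ℤ r)}} (begin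
  (+ suc r ℤ.* multichoose a (suc r)) ℤ.* + (r !)   ≡⟨ multichoose-suc-scaled a r ⟩
  rising a (suc r)                                  ≡⟨ rising-sucˡ a r ⟩
  a ℤ.* rising (1ℤ ℤ.+ a) r                         ≡⟨ cong (a ℤ.*_) (rising-multichoose (1ℤ ℤ.+ a) r) ⟩
  a ℤ.* (multichoose (1ℤ ℤ.+ a) r ℤ.* + (r !))      ≡⟨ ℤ.*-assoc a (multichoose (1ℤ ℤ.+ a) r) (+ (r !)) ⟨
  a ℤ.* multichoose (1ℤ ℤ.+ a) r ℤ.* + (r !)        ∎)

multichoose² : ℤ → ℤ → ℕ → ℤ
multichoose² a b r = multichoose a r ℤ.* multichoose b r

-- A second factor `s = suc r` gives each of the four coefficients its own `s`, so the recurrences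
-- express all of them through `x` and `y`. What remains is a b - (a + s)(b + s) = - s (a + b + s).
multichoose²-shift : ∀ a b r →
  + suc r ℤ.* (multichoose² a b (suc r) ℤ.- multichoose² (1ℤ ℤ.+ a) (1ℤ ℤ.+ b) (suc r))
    ≡ ℤ.- (a ℤ.+ b ℤ.+ + suc r) ℤ.* multichoose² (1ℤ ℤ.+ a) (1ℤ ℤ.+ b) r
multichoose²-shift a b r = ℤ.*-cancelˡ-≡ (+ suc r) _ _ (begin
  s ℤ.* (s ℤ.* (A ℤ.* B ℤ.- A′ ℤ.* B′))
    ≡⟨ distribute s A B A′ B′ ⟩
  (s ℤ.* A) ℤ.* (s ℤ.* B) ℤ.- (s ℤ.* A′) ℤ.* (s ℤ.* B′)
    ≡⟨ cong₂ ℤ._-_ (cong₂ ℤ._*_ (multichoose-sucˡ a r) (multichoose-sucˡ b r))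
                   (cong₂ ℤ._*_ (multichoose-sucʳ (1ℤ ℤ.+ a) r) (multichoose-sucʳ (1ℤ ℤ.+ b) r)) ⟩
  (a ℤ.* x) ℤ.* (b ℤ.* y) ℤ.-
    ((1ℤ ℤ.+ a ℤ.+ + r) ℤ.* x) ℤ.* ((1ℤ ℤ.+ b ℤ.+ + r) ℤ.* y)
    ≡⟨ collect a b (+ r) x y ⟩
  s ℤ.* (ℤ.- (a ℤ.+ b ℤ.+ s) ℤ.* (x ℤ.* y)) ∎)
  where
  s = + suc r
  A = multichoose a (suc r)
  B = multichoose b (suc r)
  A′ = multichoose (1ℤ ℤ.+ a) (suc r)
  B′ = multichoose (1ℤ ℤ.+ b) (suc r)
  x = multichoose (1ℤ ℤ.+ a) r
  y = multichoose (1ℤ ℤ.+ b) r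
  distribute : ∀ s A B A′ B′ → s ℤ.* (s ℤ.* (A ℤ.* B ℤ.- A′ ℤ.* B′)) ≡
    (s ℤ.* A) ℤ.* (s ℤ.* B) ℤ.- (s ℤ.* A′) ℤ.* (s ℤ.* B′)
  distribute = solve-∀
  collect : ∀ a b r x y →
    (a ℤ.* x) ℤ.* (b ℤ.* y) ℤ.-
      ((1ℤ ℤ.+ a ℤ.+ r) ℤ.* x) ℤ.* ((1ℤ ℤ.+ b ℤ.+ r) ℤ.* y) ≡
    (1ℤ ℤ.+ r) ℤ.* (ℤ.- (a ℤ.+ b ℤ.+ (1ℤ ℤ.+ r)) ℤ.* (x ℤ.* y))
  collect = solve-∀

-- Divisibility of the integer sum by `k`, by telescoping.

sumℤ< : ℕ → (ℕ → ℤ) → ℤ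
sumℤ< zero    f = 0ℤ
sumℤ< (suc m) f = sumℤ< m f ℤ.+ f m

summand : ℕ → ℕ → ℤ → ℤ → ℕ → ℤ
summand n k a b r =
  + n ℤ.* multichoose² a b r ℤ.* + ((n ∸ suc r) C (k ∸ suc r))

-- Writing `n` and `k` as offsets from `suc m` removes the subtractions: `c` and `c′` are the
-- binomial coefficients in Gₘ and Gₘ₊₁. The factor `n` splits as (N + 1) + m, and (N + 1) e = (K +
-- 1)(e + c) brings in K + 1 = k - m.
summand-telescopes : ∀ N K m a b → a ℤ.+ b ≡ ℤ.- + (suc m ℕ.+ N) →
  let n = suc m ℕ.+ N; k = suc m ℕ.+ K
      U = multichoose² a b; W = multichoose² (1ℤ ℤ.+ a) (1ℤ ℤ.+ b)
      e = + (N C K); c = + (N C suc K); c′ = + ((N ∸ 1) C K) in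
  + n ℤ.* U m ℤ.* e ≡
    + k ℤ.* (U m ℤ.* (e ℤ.+ c) ℤ.- W m ℤ.* c)
      ℤ.+ + suc m ℤ.* (U (suc m) ℤ.- W (suc m)) ℤ.* c′
      ℤ.- + m ℤ.* (U m ℤ.- W m) ℤ.* c
summand-telescopes N K m a b a+b≡-n = begin
  + n ℤ.* u ℤ.* e
    ≡⟨ split (+ m) (+ N) u e ⟩
  u ℤ.* (+ suc N ℤ.* e) ℤ.+ + m ℤ.* u ℤ.* e
    ≡⟨ cong (λ z → u ℤ.* z ℤ.+ + m ℤ.* u ℤ.* e) (pascal-absorptionℤ N K) ⟩
  u ℤ.* (+ suc K ℤ.* (e ℤ.+ c)) ℤ.+ + m ℤ.* u ℤ.* e
    -- Besides `k u (e + c)` only `- m u c` is left. Adding w c (- k + (K + 1) + m) = 0 completes it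
    -- to `- m (u - w) c` and leaves the term `w (K + 1) c`.
    ≡⟨ regroup (+ m) (+ K) u w e c ⟩
  + k ℤ.* (u ℤ.* (e ℤ.+ c) ℤ.- w ℤ.* c)
    ℤ.+ w ℤ.* (+ suc K ℤ.* c) ℤ.- + m ℤ.* (u ℤ.- w) ℤ.* c
    ≡⟨ cong (λ z → + k ℤ.* (u ℤ.* (e ℤ.+ c) ℤ.- w ℤ.* c) ℤ.+ z ℤ.- + m ℤ.* (u ℤ.- w) ℤ.* c)
         boundary ⟩
  + k ℤ.* (u ℤ.* (e ℤ.+ c) ℤ.- w ℤ.* c)
    ℤ.+ + suc m ℤ.* (U (suc m) ℤ.- W (suc m)) ℤ.* c′ ℤ.- + m ℤ.* (u ℤ.- w) ℤ.* c ∎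
  where
  n = suc m ℕ.+ N
  k = suc m ℕ.+ K
  U = multichoose² a b
  W = multichoose² (1ℤ ℤ.+ a) (1ℤ ℤ.+ b)
  u = U m
  w = W m
  e = + (N C K)
  c = + (N C suc K)
  c′ = + ((N ∸ 1) C K)
  split : ∀ m N u e → (1ℤ ℤ.+ m ℤ.+ N) ℤ.* u ℤ.* e ≡
    u ℤ.* ((1ℤ ℤ.+ N) ℤ.* e) ℤ.+ m ℤ.* u ℤ.* e
  split = solve-∀
  regroup : ∀ m K u w e c → u ℤ.* ((1ℤ ℤ.+ K) ℤ.* (e ℤ.+ c)) ℤ.+ m ℤ.* u ℤ.* e ≡
    (1ℤ ℤ.+ m ℤ.+ K) ℤ.* (u ℤ.* (e ℤ.+ c) ℤ.- w ℤ.* c)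
      ℤ.+ w ℤ.* ((1ℤ ℤ.+ K) ℤ.* c) ℤ.- m ℤ.* (u ℤ.- w) ℤ.* c
  regroup = solve-∀
  assoc : ∀ m N w c → w ℤ.* (N ℤ.* c) ≡
    ℤ.- (ℤ.- (1ℤ ℤ.+ m ℤ.+ N) ℤ.+ (1ℤ ℤ.+ m)) ℤ.* w ℤ.* c
  assoc = solve-∀
  -- Absorption produces the factor `N`, and N = n - (m + 1) = - (a + b + m + 1) is the coefficient
  -- in `multichoose²-shift`.
  boundary : w ℤ.* (+ suc K ℤ.* c) ≡ + suc m ℤ.* (U (suc m) ℤ.- W (suc m)) ℤ.* c′
  boundary = begin
    w ℤ.* (+ suc K ℤ.* c)                            ≡⟨ cong (w ℤ.*_) (absorptionℤ N K) ⟩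
    w ℤ.* (+ N ℤ.* c′)                               ≡⟨ assoc (+ m) (+ N) w c′ ⟩
    ℤ.- (ℤ.- + n ℤ.+ + suc m) ℤ.* w ℤ.* c′           ≡⟨ cong (λ z → ℤ.- (z ℤ.+ + suc m) ℤ.* w ℤ.* c′) a+b≡-n ⟨
    ℤ.- (a ℤ.+ b ℤ.+ + suc m) ℤ.* w ℤ.* c′           ≡⟨ cong (ℤ._* c′) (multichoose²-shift a b m) ⟨
    + suc m ℤ.* (U (suc m) ℤ.- W (suc m)) ℤ.* c′     ∎

module _ (n k : ℕ) (a b : ℤ) (k≤n : k ≤ n) (a+b≡-n : a ℤ.+ b ≡ ℤ.- + n) where

  G : ℕ → ℤ
  G m = + m ℤ.*
    (multichoose² a b m ℤ.- multichoose² (1ℤ ℤ.+ a) (1ℤ ℤ.+ b) m) ℤ.*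
    + ((n ∸ suc m) C (k ∸ m))

  summand≡ΔG-mod-k : ∀ m → m < k → ∃[ z ]
    summand n k a b m ≡ + k ℤ.* z ℤ.+ G (suc m) ℤ.- G m
  summand≡ΔG-mod-k m m<k
    with K , refl ← ℕ.m≤n⇒∃[o]m+o≡n m<k
       | N , refl ← ℕ.m≤n⇒∃[o]m+o≡n (ℕ.≤-trans m<k k≤n) = z , (begin
    + n ℤ.* U m ℤ.* + ((m ℕ.+ N ∸ m) C (m ℕ.+ K ∸ m))
      ≡⟨ cong (λ x → + n ℤ.* U m ℤ.* + x) (cong₂ _C_ N≡ K≡) ⟩
    + n ℤ.* U m ℤ.* + (N C K)
      ≡⟨ summand-telescopes N K m a b a+b≡-n ⟩
    + k ℤ.* z ℤ.+ δ (suc m) ℤ.* + ((N ∸ 1) C K) ℤ.- δ m ℤ.* + (N C suc K)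
      ≡⟨ cong₂ (λ x y → + k ℤ.* z ℤ.+ δ (suc m) ℤ.* + x ℤ.- δ m ℤ.* + y)
           (cong₂ _C_ N∸1≡ K≡) (cong₂ _C_ N≡ 1+K≡) ⟨
    + k ℤ.* z ℤ.+ G (suc m) ℤ.- G m ∎)
    where
    U = multichoose² a b
    W = multichoose² (1ℤ ℤ.+ a) (1ℤ ℤ.+ b)
    δ : ℕ → ℤ
    δ m = + m ℤ.* (U m ℤ.- W m)
    z = U m ℤ.* (+ (N C K) ℤ.+ + (N C suc K)) ℤ.- W m ℤ.* + (N C suc K)
    N≡ : m ℕ.+ N ∸ m ≡ N
    N≡ = ℕ.m+n∸m≡n m N
    K≡ : m ℕ.+ K ∸ m ≡ K
    K≡ = ℕ.m+n∸m≡n m K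
    1+K≡ : suc m ℕ.+ K ∸ m ≡ suc K
    1+K≡ = trans (cong (_∸ m) (sym (ℕ.+-suc m K))) (ℕ.m+n∸m≡n m (suc K))
    N∸1≡ : m ℕ.+ N ∸ suc m ≡ N ∸ 1
    N∸1≡ = trans (sym (ℕ.pred[m∸n]≡m∸[1+n] (m ℕ.+ N) m)) (cong (_∸ 1) N≡)

  partial-sum≡G-mod-k : ∀ m → m ≤ k → ∃[ z ]
    sumℤ< m (summand n k a b) ≡ + k ℤ.* z ℤ.+ G m
  -- `G 0` reduces to `0ℤ` because of its leading factor `+ 0`.
  partial-sum≡G-mod-k zero    _   = 0ℤ , sym (cong (ℤ._+ 0ℤ) (ℤ.*-zeroʳ (+ k)))
  partial-sum≡G-mod-k (suc m) m<k
    with y , y-eq ← partial-sum≡G-mod-k m (ℕ.<⇒≤ m<k)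
       | z , z-eq ← summand≡ΔG-mod-k m m<k
    = y ℤ.+ z , trans (cong₂ ℤ._+_ y-eq z-eq) (cancel (+ k) y z (G m) (G (suc m)))
    where
    cancel : ∀ k y z g g′ →
      (k ℤ.* y ℤ.+ g) ℤ.+ (k ℤ.* z ℤ.+ g′ ℤ.- g) ≡ k ℤ.* (y ℤ.+ z) ℤ.+ g′
    cancel = solve-∀

  k∣sum-summand : ∃[ z ] sumℤ< k (summand n k a b) ≡ + k ℤ.* z
  k∣sum-summand with z , eq ← partial-sum≡G-mod-k k ℕ.≤-refl =
    -- The leading factor of `G k` is `k` itself, so the last boundary term is also a multiple of
    -- `k`.
    z ℤ.+ d ℤ.* c , trans eq (factor (+ k) z d c)
    where
    d = multichoose² a b k ℤ.- multichoose² (1ℤ ℤ.+ a) (1ℤ ℤ.+ b) k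
    c = + ((n ∸ suc k) C (k ∸ k))
    factor : ∀ k z d c → k ℤ.* z ℤ.+ k ℤ.* d ℤ.* c ≡ k ℤ.* (z ℤ.+ d ℤ.* c)
    factor = solve-∀

-- From the hypergeometric terms to the integer summands.

-- The ratio (1-k)ᵣ / (1-n)ᵣ, cross-multiplied, lowers both entries of the binomial coefficient.
-- Passing from `r` to `suc r` adds the factors 1 - k + r = - (K + 1) and 1 - n + r = - N, which
-- absorption exchanges.
binomial-rising : ∀ {n k} r → r < k → k ≤ n →
  + k ℤ.* + (n C k) ℤ.* rising (1ℤ ℤ.- + k) r ≡
    + n ℤ.* + ((n ∸ suc r) C (k ∸ suc r)) ℤ.* rising (1ℤ ℤ.- + n) r
binomial-rising {n} {suc k} zero    _     k≤n = cong (ℤ._* 1ℤ) (absorptionℤ n k)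
binomial-rising {n} {k}     (suc r) 1+r<k k≤n
  with K , refl ← ℕ.m≤n⇒∃[o]m+o≡n 1+r<k
     | N , refl ← ℕ.m≤n⇒∃[o]m+o≡n (ℕ.≤-trans (ℕ.<⇒≤ 1+r<k) k≤n) = begin
  + k ℤ.* + (n C k) ℤ.* (ρ ℤ.* (1ℤ ℤ.- + k ℤ.+ + r))
    ≡⟨ ℤ.*-assoc (+ k ℤ.* + (n C k)) ρ (1ℤ ℤ.- + k ℤ.+ + r) ⟨
  + k ℤ.* + (n C k) ℤ.* ρ ℤ.* (1ℤ ℤ.- + k ℤ.+ + r)
    ≡⟨ cong (ℤ._* (1ℤ ℤ.- + k ℤ.+ + r)) (binomial-rising r (ℕ.<⇒≤ 1+r<k) k≤n) ⟩
  + n ℤ.* + ((r ℕ.+ N ∸ r) C (suc r ℕ.+ K ∸ r)) ℤ.* σ ℤ.* (1ℤ ℤ.- + k ℤ.+ + r)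
    ≡⟨ cong (λ x → + n ℤ.* + x ℤ.* σ ℤ.* (1ℤ ℤ.- + k ℤ.+ + r)) (cong₂ _C_ N≡ 1+K≡) ⟩
  + n ℤ.* + (N C suc K) ℤ.* σ ℤ.* (1ℤ ℤ.- + k ℤ.+ + r)
    ≡⟨ left (+ r) (+ K) (+ n) (+ (N C suc K)) σ ⟩
  ℤ.- (+ n ℤ.* (+ suc K ℤ.* + (N C suc K)) ℤ.* σ)
    ≡⟨ cong (λ x → ℤ.- (+ n ℤ.* x ℤ.* σ)) (absorptionℤ N K) ⟩
  ℤ.- (+ n ℤ.* (+ N ℤ.* + ((N ∸ 1) C K)) ℤ.* σ)
    ≡⟨ right (+ r) (+ N) (+ ((N ∸ 1) C K)) σ ⟩
  + n ℤ.* + ((N ∸ 1) C K) ℤ.* (σ ℤ.* (1ℤ ℤ.- + n ℤ.+ + r))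
    ≡⟨ cong (λ x → + n ℤ.* + x ℤ.* (σ ℤ.* (1ℤ ℤ.- + n ℤ.+ + r))) (cong₂ _C_ N∸1≡ K≡) ⟨
  + n ℤ.* + ((r ℕ.+ N ∸ suc r) C (r ℕ.+ K ∸ r)) ℤ.* (σ ℤ.* (1ℤ ℤ.- + n ℤ.+ + r)) ∎
  where
  ρ = rising (1ℤ ℤ.- + k) r
  σ = rising (1ℤ ℤ.- + n) r
  N≡ : r ℕ.+ N ∸ r ≡ N
  N≡ = ℕ.m+n∸m≡n r N
  K≡ : r ℕ.+ K ∸ r ≡ K
  K≡ = ℕ.m+n∸m≡n r K
  1+K≡ : suc r ℕ.+ K ∸ r ≡ suc K
  1+K≡ = trans (cong (_∸ r) (sym (ℕ.+-suc r K))) (ℕ.m+n∸m≡n r (suc K))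
  N∸1≡ : r ℕ.+ N ∸ suc r ≡ N ∸ 1
  N∸1≡ = trans (sym (ℕ.pred[m∸n]≡m∸[1+n] (r ℕ.+ N) r)) (cong (_∸ 1) N≡)
  left : ∀ r K n c σ → n ℤ.* c ℤ.* σ ℤ.* (1ℤ ℤ.- (1ℤ ℤ.+ (1ℤ ℤ.+ r ℤ.+ K)) ℤ.+ r) ≡
    ℤ.- (n ℤ.* ((1ℤ ℤ.+ K) ℤ.* c) ℤ.* σ)
  left = solve-∀
  right : ∀ r N c σ → ℤ.- ((1ℤ ℤ.+ r ℤ.+ N) ℤ.* (N ℤ.* c) ℤ.* σ) ≡
    (1ℤ ℤ.+ r ℤ.+ N) ℤ.* c ℤ.* (σ ℤ.* (1ℤ ℤ.- (1ℤ ℤ.+ r ℤ.+ N) ℤ.+ r))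
  right = solve-∀

rising-1 : ∀ r → rising 1ℤ r ≡ + (r !)
rising-1 zero    = refl
rising-1 (suc r) = begin
  rising 1ℤ r ℤ.* + suc r ≡⟨ cong (ℤ._* + suc r) (rising-1 r) ⟩
  + (r !) ℤ.* + suc r     ≡⟨ ℤ.*-comm (+ (r !)) (+ suc r) ⟩
  + suc r ℤ.* + (r !)     ≡⟨ !-suc r ⟨
  + (suc r !)             ∎

-- The embedding of the integers into the rationals.

toℚᵘ-/1 : ∀ i → ℚ.toℚᵘ (i / 1) ℚᵘ.≃ mkℚᵘ i 0
toℚᵘ-/1 i = ℚ.toℚᵘ-fromℚᵘ (mkℚᵘ i 0)

-- The gcd in `i / 1` does not compute for a variable `i`, so the identity is checked on
-- unnormalised fractions with denominator 1.
/1-homo-* : ∀ i j → (i ℤ.* j) / 1 ≡ (i / 1) ℚ.* (j / 1)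
/1-homo-* i j = ℚ.toℚᵘ-injective (ℚᵘ.≃-trans (toℚᵘ-/1 (i ℤ.* j))
  (ℚᵘ.≃-sym (ℚᵘ.≃-trans (ℚ.toℚᵘ-homo-* (i / 1) (j / 1))
    (ℚᵘ.*-cong (toℚᵘ-/1 i) (toℚᵘ-/1 j)))))

/1-homo-+ : ∀ i j → (i ℤ.+ j) / 1 ≡ (i / 1) ℚ.+ (j / 1)
/1-homo-+ i j = ℚ.toℚᵘ-injective (ℚᵘ.≃-trans (toℚᵘ-/1 (i ℤ.+ j))
  (ℚᵘ.≃-sym (ℚᵘ.≃-trans (ℚ.toℚᵘ-homo-+ (i / 1) (j / 1))
    (ℚᵘ.≃-trans (ℚᵘ.+-cong (toℚᵘ-/1 i) (toℚᵘ-/1 j)) (*≡* (clear i j))))))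
  where
  clear : ∀ i j → (i ℤ.* 1ℤ ℤ.+ j ℤ.* 1ℤ) ℤ.* 1ℤ ≡ (i ℤ.+ j) ℤ.* 1ℤ
  clear = solve-∀

/1-injective : ∀ {i j} → i / 1 ≡ j / 1 → i ≡ j
/1-injective {i} {j} eq
  with *≡* e ← ℚᵘ.≃-trans (ℚᵘ.≃-sym (toℚᵘ-/1 i))
                 (ℚᵘ.≃-trans (ℚᵘ.≃-reflexive (cong ℚ.toℚᵘ eq)) (toℚᵘ-/1 j))
  = ℤ.*-cancelʳ-≡ i j 1ℤ e

-- Cross-multiplication: `b ≢ 0ℤ` rules out the default value of `÷₀`, as `_/ 1` is injective.
*-÷₀-cancel : ∀ c a b x → b ≢ 0ℤ → c ℤ.* a ≡ x ℤ.* b →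
  (c / 1) ℚ.* ((a / 1) ÷₀ (b / 1)) ≡ x / 1
*-÷₀-cancel c a b x b≢0 ca≡xb with (b / 1) ℚ.≟ 0ℚ
... | yes b≡0 = contradiction (/1-injective b≡0) b≢0
... | no  b≢0 = begin
  (c / 1) ℚ.* ((a / 1) ℚ.* ℚ.1/ (b / 1))    ≡⟨ ℚ.*-assoc (c / 1) (a / 1) (ℚ.1/ (b / 1)) ⟨
  (c / 1) ℚ.* (a / 1) ℚ.* ℚ.1/ (b / 1)      ≡⟨ cong (ℚ._* ℚ.1/ (b / 1)) (/1-homo-* c a) ⟨
  (c ℤ.* a) / 1 ℚ.* ℚ.1/ (b / 1)            ≡⟨ cong (λ y → y / 1 ℚ.* ℚ.1/ (b / 1)) ca≡xb ⟩
  (x ℤ.* b) / 1 ℚ.* ℚ.1/ (b / 1)            ≡⟨ cong (ℚ._* ℚ.1/ (b / 1)) (/1-homo-* x b) ⟩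
  (x / 1) ℚ.* (b / 1) ℚ.* ℚ.1/ (b / 1)      ≡⟨ ℚ.*-assoc (x / 1) (b / 1) (ℚ.1/ (b / 1)) ⟩
  (x / 1) ℚ.* ((b / 1) ℚ.* ℚ.1/ (b / 1))    ≡⟨ cong ((x / 1) ℚ.*_) (ℚ.*-inverseʳ (b / 1)) ⟩
  (x / 1) ℚ.* ℚ.1ℚ                          ≡⟨ ℚ.*-identityʳ (x / 1) ⟩
  x / 1                                     ∎
  where instance _ = ≢-nonZero b≢0

sum<-scale : ∀ c m {f : ℕ → ℚ} {g : ℕ → ℤ} → (∀ r → r < m → c ℚ.* f r ≡ g r / 1) →
  c ℚ.* sum< m f ≡ sumℤ< m g / 1
sum<-scale c zero    eq = ℚ.*-zeroʳ c
sum<-scale c (suc m) {f} {g} eq = begin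
  c ℚ.* (sum< m f ℚ.+ f m)           ≡⟨ ℚ.*-distribˡ-+ c (sum< m f) (f m) ⟩
  c ℚ.* sum< m f ℚ.+ c ℚ.* f m       ≡⟨ cong₂ ℚ._+_ (sum<-scale c m (λ r → eq r ∘ ℕ.m<n⇒m<1+n)) (eq m (ℕ.n<1+n m)) ⟩
  sumℤ< m g / 1 ℚ.+ g m / 1          ≡⟨ /1-homo-+ (sumℤ< m g) (g m) ⟨
  (sumℤ< m g ℤ.+ g m) / 1            ∎

-- The prefactor `k (n C k)` moves into each term, where `binomial-rising` removes (1-k)ᵣ / (1-n)ᵣ.
-- The denominators (1)ᵣ and `r !`, both equal to `r !`, turn the other two rising factorials into
-- multichoose coefficients.
k⟨⟩-as-sum : ∀ n p k → k ≤ n → (+ k / 1) ℚ.* ⟨ n , p ⟩ k ≡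
  sumℤ< k (summand n k (ℤ.- + p) (+ p ℤ.- + n)) / 1
k⟨⟩-as-sum n p k k≤n = begin
  (+ k / 1) ℚ.* ((+ (n C k) / 1) ℚ.* S)    ≡⟨ ℚ.*-assoc (+ k / 1) (+ (n C k) / 1) S ⟨
  (+ k / 1) ℚ.* (+ (n C k) / 1) ℚ.* S      ≡⟨ cong (ℚ._* S) (/1-homo-* (+ k) (+ (n C k))) ⟨
  ((+ k ℤ.* + (n C k)) / 1) ℚ.* S          ≡⟨ sum<-scale ((+ k ℤ.* + (n C k)) / 1) k term ⟩
  sumℤ< k (summand n k a b) / 1            ∎
  where
  a = ℤ.- + p
  b = + p ℤ.- + n
  S = sum< k (₃F₂-term (1ℤ ℤ.- + k) a b (1ℤ ℤ.- + n) 1ℤ)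
  term : ∀ r → r < k →
    ((+ k ℤ.* + (n C k)) / 1) ℚ.* ₃F₂-term (1ℤ ℤ.- + k) a b (1ℤ ℤ.- + n) 1ℤ r ≡
      summand n k a b r / 1
  term r r<k = *-÷₀-cancel κ (ρ ℤ.* rising a r ℤ.* rising b r) (σ ℤ.* rising 1ℤ r ℤ.* f) (summand n k a b r) den≢0 (begin
    κ ℤ.* (ρ ℤ.* rising a r ℤ.* rising b r)
      ≡⟨ cong₂ (λ x y → κ ℤ.* (ρ ℤ.* x ℤ.* y)) (rising-multichoose a r) (rising-multichoose b r) ⟩
    κ ℤ.* (ρ ℤ.* (A ℤ.* f) ℤ.* (B ℤ.* f))
      ≡⟨ pull κ ρ A B f ⟩
    (κ ℤ.* ρ) ℤ.* (A ℤ.* B ℤ.* f ℤ.* f)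
      ≡⟨ cong (ℤ._* (A ℤ.* B ℤ.* f ℤ.* f)) (binomial-rising r r<k k≤n) ⟩
    (+ n ℤ.* e ℤ.* σ) ℤ.* (A ℤ.* B ℤ.* f ℤ.* f)
      ≡⟨ push (+ n) e σ A B f ⟩
    + n ℤ.* (A ℤ.* B) ℤ.* e ℤ.* (σ ℤ.* f ℤ.* f)
      ≡⟨ cong (λ x → + n ℤ.* (A ℤ.* B) ℤ.* e ℤ.* (σ ℤ.* x ℤ.* f)) (rising-1 r) ⟨
    + n ℤ.* (A ℤ.* B) ℤ.* e ℤ.* (σ ℤ.* rising 1ℤ r ℤ.* f) ∎)
    where
    κ = + k ℤ.* + (n C k)
    ρ = rising (1ℤ ℤ.- + k) r
    σ = rising (1ℤ ℤ.- + n) r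
    f = + (r !)
    A = multichoose a r
    B = multichoose b r
    e = + ((n ∸ suc r) C (k ∸ suc r))
    pull : ∀ κ ρ A B f → κ ℤ.* (ρ ℤ.* (A ℤ.* f) ℤ.* (B ℤ.* f)) ≡
      (κ ℤ.* ρ) ℤ.* (A ℤ.* B ℤ.* f ℤ.* f)
    pull = solve-∀
    push : ∀ n e σ A B f → (n ℤ.* e ℤ.* σ) ℤ.* (A ℤ.* B ℤ.* f ℤ.* f) ≡
      n ℤ.* (A ℤ.* B) ℤ.* e ℤ.* (σ ℤ.* f ℤ.* f)
    push = solve-∀
    den≢0 : σ ℤ.* rising 1ℤ r ℤ.* f ≢ 0ℤ
    den≢0 eq with ℤ.i*j≡0⇒i≡0∨j≡0 (σ ℤ.* rising 1ℤ r) eq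
    ... | inj₂ f≡0 = !≢0ℤ r f≡0
    ... | inj₁ eq′ with ℤ.i*j≡0⇒i≡0∨j≡0 σ eq′
    ...   | inj₁ σ≡0 = rising-nonzero r (ℕ.<-≤-trans r<k k≤n) σ≡0
    ...   | inj₂ f≡0 = !≢0ℤ r (trans (sym (rising-1 r)) f≡0)

-- Positivity of the integer sum.

*-nonNeg : ∀ i j → 0ℤ ℤ.≤ i → 0ℤ ℤ.≤ j → 0ℤ ℤ.≤ i ℤ.* j
*-nonNeg (+ m) (+ n) _ _ = subst (0ℤ ℤ.≤_) (ℤ.pos-* m n) (ℤ.+≤+ z≤n)

rising-neg-vanishes : ∀ {p r} → p < r → rising (ℤ.- + p) r ≡ 0ℤ
rising-neg-vanishes {p} {r} p<r = trans (cong (λ a → rising a r) (shift (+ p)))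
  (rising-vanishes {suc p} (s≤s z≤n) p<r)
  where
  shift : ∀ p → ℤ.- p ≡ 1ℤ ℤ.- (1ℤ ℤ.+ p)
  shift = solve-∀

-- The signs cancel in pairs: (- p + r)(- q + r) = p′ q′ with `p′`, `q′` natural while `r` is at
-- most `p` and `q`. Beyond that, one of the two products contains a zero factor.
rising-neg²-nonNeg : ∀ p q r → 0ℤ ℤ.≤ rising (ℤ.- + p) r ℤ.* rising (ℤ.- + q) r
rising-neg²-nonNeg p q zero    = ℤ.+≤+ z≤n
rising-neg²-nonNeg p q (suc r) with r ℕ.≤? p | r ℕ.≤? q
... | no r≰p | _      = ℤ.≤-reflexive (sym (cong (ℤ._* rising (ℤ.- + q) (suc r))
                          (rising-neg-vanishes (ℕ.m<n⇒m<1+n (ℕ.≰⇒> r≰p)))))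
... | yes _  | no r≰q = ℤ.≤-reflexive (sym (trans
                          (cong (rising (ℤ.- + p) (suc r) ℤ.*_)
                            (rising-neg-vanishes (ℕ.m<n⇒m<1+n (ℕ.≰⇒> r≰q))))
                          (ℤ.*-zeroʳ (rising (ℤ.- + p) (suc r)))))
... | yes r≤p | yes r≤q
  with p′ , refl ← ℕ.m≤n⇒∃[o]m+o≡n r≤p
     | q′ , refl ← ℕ.m≤n⇒∃[o]m+o≡n r≤q
  = subst (0ℤ ℤ.≤_) (sym (regroup (+ r) (+ p′) (+ q′) x y))
      (*-nonNeg (x ℤ.* y) (+ p′ ℤ.* + q′) (rising-neg²-nonNeg p q r)
        (*-nonNeg (+ p′) (+ q′) (ℤ.+≤+ z≤n) (ℤ.+≤+ z≤n)))
  where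
  x = rising (ℤ.- + p) r
  y = rising (ℤ.- + q) r
  regroup : ∀ r p q x y →
    x ℤ.* (ℤ.- (r ℤ.+ p) ℤ.+ r) ℤ.* (y ℤ.* (ℤ.- (r ℤ.+ q) ℤ.+ r)) ≡ x ℤ.* y ℤ.* (p ℤ.* q)
  regroup = solve-∀

-- The value is C(p, r) C(q, r), the two signs (-1)ʳ cancelling; the proof divides the preceding
-- inequality twice by `r !`.
multichoose²-neg-nonNeg : ∀ p q r → 0ℤ ℤ.≤ multichoose² (ℤ.- + p) (ℤ.- + q) r
multichoose²-neg-nonNeg p q r =
  ℤ.*-cancelʳ-≤-pos 0ℤ _ (+ (r !)) {{r!>0}} (ℤ.*-cancelʳ-≤-pos 0ℤ _ (+ (r !)) {{r!>0}}
    (subst (0ℤ ℤ.≤_) scaled (rising-neg²-nonNeg p q r)))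
  where
  r!>0 : ℤ.Positive (+ (r !))
  r!>0 = ℤ.positive (ℤ.+<+ (ℕ.1≤n! r))
  regroup : ∀ x y f → (x ℤ.* f) ℤ.* (y ℤ.* f) ≡ x ℤ.* y ℤ.* f ℤ.* f
  regroup = solve-∀
  scaled : rising (ℤ.- + p) r ℤ.* rising (ℤ.- + q) r ≡
    multichoose² (ℤ.- + p) (ℤ.- + q) r ℤ.* + (r !) ℤ.* + (r !)
  scaled = trans
    (cong₂ ℤ._*_ (rising-multichoose (ℤ.- + p) r) (rising-multichoose (ℤ.- + q) r))
    (regroup (multichoose (ℤ.- + p) r) (multichoose (ℤ.- + q) r) (+ (r !)))

sumℤ<-pos : ∀ m {f : ℕ → ℤ} → 0ℤ ℤ.< f 0 → (∀ r → 0ℤ ℤ.≤ f r) → 0ℤ ℤ.< sumℤ< (suc m) f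
sumℤ<-pos zero    {f} 0<f₀ 0≤f = subst (0ℤ ℤ.<_) (sym (ℤ.+-identityˡ (f 0))) 0<f₀
sumℤ<-pos (suc m) 0<f₀ 0≤f = ℤ.+-mono-<-≤ (sumℤ<-pos m 0<f₀ 0≤f) (0≤f (suc m))

-- The term at `r = 0` is n C(n-1, k-1), positive by `k ≤ n`. The others are nonnegative because
-- `p ≤ n` makes `p - n` the negative of a natural number.
sum-summand-pos : ∀ n p k → .{{NonZero k}} → p ≤ n → k ≤ n →
  0ℤ ℤ.< sumℤ< k (summand n k (ℤ.- + p) (+ p ℤ.- + n))
sum-summand-pos (suc n) p (suc k) p≤n k≤n with q , p+q≡n ← ℕ.m≤n⇒∃[o]m+o≡n p≤n =
  sumℤ<-pos k
    (subst (0ℤ ℤ.<_) (trans (ℤ.pos-* (suc n) (n C k)) (cong (ℤ._* + (n C k)) (sym (ℤ.*-identityʳ (+ suc n)))))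
      (ℤ.+<+ (ℕ.*-mono-≤ (s≤s (z≤n {n})) (0<nCk (ℕ.s≤s⁻¹ k≤n)))))
    (λ r → *-nonNeg (+ suc n ℤ.* U r) (+ ((suc n ∸ suc r) C (suc k ∸ suc r)))
      (*-nonNeg (+ suc n) (U r) (ℤ.+≤+ z≤n) (U-nonNeg r)) (ℤ.+≤+ z≤n))
  where
  cancel : ∀ p q → ℤ.- q ≡ p ℤ.- (p ℤ.+ q)
  cancel = solve-∀
  -q≡p-n : ℤ.- + q ≡ + p ℤ.- + suc n
  -q≡p-n = trans (cancel (+ p) (+ q)) (cong (λ m → + p ℤ.- + m) p+q≡n)
  U = multichoose² (ℤ.- + p) (+ p ℤ.- + suc n)
  U-nonNeg : ∀ r → 0ℤ ℤ.≤ U r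
  U-nonNeg r = subst (λ b → 0ℤ ℤ.≤ multichoose² (ℤ.- + p) b r) -q≡p-n
    (multichoose²-neg-nonNeg p q r)

-- Division by `k`, integrality and positivity.

-i+[i-j]≡-j : ∀ i j → ℤ.- i ℤ.+ (i ℤ.- j) ≡ ℤ.- j
-i+[i-j]≡-j = solve-∀

-- Multiplication by a positive rational reflects the order, so antisymmetry gives the equality.
/1-*-cancelˡ : ∀ k {x y} → .{{NonZero k}} → (+ k / 1) ℚ.* x ≡ (+ k / 1) ℚ.* y → x ≡ y
/1-*-cancelˡ k e = ℚ.≤-antisym
  (ℚ.*-cancelˡ-≤-pos (+ k / 1) (ℚ.≤-reflexive e))
  (ℚ.*-cancelˡ-≤-pos (+ k / 1) (ℚ.≤-reflexive (sym e)))
  where instance _ = ℚ.normalize-pos k 1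

sum≡kz⇒⟨⟩≡z : ∀ n p k {z} → .{{NonZero k}} → k ≤ n →
  sumℤ< k (summand n k (ℤ.- + p) (+ p ℤ.- + n)) ≡ + k ℤ.* z → ⟨ n , p ⟩ k ≡ z / 1
sum≡kz⇒⟨⟩≡z n p k {z} k≤n eq = /1-*-cancelˡ k
  (trans (k⟨⟩-as-sum n p k k≤n) (trans (cong (_/ 1) eq) (/1-homo-* (+ k) z)))

/1-pos : ∀ z → 0ℤ ℤ.< z → Positive (z / 1)
/1-pos (+ suc z) _ = ℚ.normalize-pos (suc z) 1
/1-pos (+ zero) (ℤ.+<+ ())

theorem1 : (n p k : ℕ) → .{{NonZero n}} → .{{NonZero p}} → .{{NonZero k}} →
    IsInteger (⟨ n , p ⟩ k) × (p ≤ n → k ≤ n → Positive (⟨ n , p ⟩ k))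
theorem1 n p k = integral , positive
  where
  k∣sum : k ≤ n → ∃[ z ] sumℤ< k (summand n k (ℤ.- + p) (+ p ℤ.- + n)) ≡ + k ℤ.* z
  k∣sum k≤n =
    k∣sum-summand n k (ℤ.- + p) (+ p ℤ.- + n) k≤n (-i+[i-j]≡-j (+ p) (+ n))

  integral : IsInteger (⟨ n , p ⟩ k)
  integral with k ℕ.≤? n
  ... | yes k≤n = map₂ (sum≡kz⇒⟨⟩≡z n p k k≤n) (k∣sum k≤n)
  -- For `k > n` the prefactor `n C k` is zero, and the integer is 0.
  ... | no  k≰n = 0ℤ , trans
    (cong (λ c → (+ c / 1) ℚ.* S) (k>n⇒nCk≡0 (ℕ.≰⇒> k≰n))) (ℚ.*-zeroˡ S)
    where S = sum< k (₃F₂-term (1ℤ ℤ.- + k) (ℤ.- + p) (+ p ℤ.- + n) (1ℤ ℤ.- + n) 1ℤ)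

  positive : p ≤ n → k ≤ n → Positive (⟨ n , p ⟩ k)
  -- The quotient `z` is positive because `k z` equals the positive sum.
  positive p≤n k≤n = subst Positive (sym (sum≡kz⇒⟨⟩≡z n p k k≤n sum≡kz))
    (/1-pos z (ℤ.*-cancelˡ-<-nonNeg (+ k)
      (subst₂ ℤ._<_ (sym (ℤ.*-zeroʳ (+ k))) sum≡kz (sum-summand-pos n p k p≤n k≤n))))
    where
    z = proj₁ (k∣sum k≤n)
    sum≡kz = proj₂ (k∣sum k≤n)
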